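{- Let $n$ be a nonnegative integer and let $k$ be an integer with $0\le k\le n-2$. Then there is a weight preserving bijection $$\phi_{n,k}\colon\; P_{n,k}\,\cup\,\big(\{2n-1\}\times P_{n-1,k-1}\big)\;\longrightarrow\; P_{n-1,k-1}\,\cup\,\big(\{2n-3\}\times P_{n-2,k}\big),$$ where the unions are disjoint unions; that is, $\phi_{n,k}$ is a bijection with $w(\phi_{n,k}(\alpha))=w(\alpha)$ for every $\alpha$ in its domain.
   Context: A partition is a nonincreasing finite sequence of positive integers $\lambda=(\lambda_1,\dots,\lambda_\ell)$; $|\lambda|$ is the sum of its parts, $\ell(\lambda)$ the number of its parts, and $\emptyset$ the partition with no parts. Let $D$ be the set of partitions with pairwise distinct parts and $E$ the set of partitions all of whose parts are even (both contain $\emptyset$). For integers $0\le k\le n$, $P_{n,k}$ is the set of triples $(\tau,\lambda,\mu)$ such that: - $\tau=(n-k-1,n-k-2,\dots,2,1,0)$, the fixed sequence of length $n-k$, whose last entry $0$ is counted as a part (so $\tau=(0)$ if $k=n-1$, and $\tau=\emptyset$ if $k=n$; the sequence $(0)$ and the empty sequence $\emptyset$ are considered different); - $\lambda\in D$ and every part $\lambda_i$ of $\lambda$ satisfies $n-k+1\le\lambda_i\le n+k$; - $\mu\in E$ and every part of $\mu$ is at most $2k$. In particular $P_{n,0}=\{((n-1,\dots,1,0),\emptyset,\emptyset)\}$. For $k>n$ or $k<0$, $P_{n,k}=\emptyset$. The weight $w$ takes values in signed powers of the indeterminate $q$: for a triple, $w(\tau,\lambda,\mu)=(-1)^{\ell(\lambda)}q^{|\tau|+|\lambda|+|\mu|}$,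 where $|\tau|$ is the sum of the entries of $\tau$; and for an integer $m\in\{2n-1,2n-3\}$ paired with a triple, $w(m,(\tau,\lambda,\mu))=q^{m}(-1)^{\ell(\lambda)}q^{|\tau|+|\lambda|+|\mu|}$. -}

module Defs where

open import Data.Nat as ℕ using (ℕ; zero; suc)
open import Data.Nat.Divisibility using (_∣_)
open import Data.Nat.ListAction using (sum)
open import Data.Integer using (ℤ; +_; 0ℤ; 1ℤ; _+_; _-_; _*_; _≤_; ∣_∣)
open import Data.List using (List; length; downFrom)
open import Data.List.Relation.Unary.All using (All)
open import Data.List.Relation.Unary.Linked using (Linked)
open import Data.List.Relation.Unary.Unique.Propositional using (Unique)
open import Data.Product using (Σ; ∃; _×_; _,_; proj₁)
open import Data.Sign as Sign using (Sign)
open import Data.Sum using (_⊎_; [_,_])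
open import Relation.Binary.PropositionalEquality using (_≡_)
open import Relation.Unary using (｛_｝)

record IsPartition (xs : List ℕ) : Set where
  constructor mkIsPartition
  field
    nonincreasing : Linked ℕ._≥_ xs
    positive      : All (0 ℕ.<_) xs

record D (xs : List ℕ) : Set where
  constructor mkD
  field
    isPartition : IsPartition xs
    distinct    : Unique xs

record E (xs : List ℕ) : Set where
  constructor mkE
  field
    isPartition : IsPartition xs
    even        : All (2 ∣_) xs

record Triple : Set where
  constructor triple
  field
    τ  : List ℕ
    λ′ : List ℕ
    μ  : List ℕ

-- The two bounds on k make this uninhabited for k < 0 and for k > n; they also
-- give ∣ n - k ∣ = n - k.  downFrom m is the list m - 1, …, 1, 0 of length m.
-- Every field is a proposition, so elements of P n k below are equal as soon
-- as their underlying triples are.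
record InP (n k : ℤ) (t : Triple) : Set where
  constructor mkInP
  open Triple t
  field
    0≤k     : 0ℤ ≤ k
    k≤n     : k ≤ n
    τ-fixed : τ ≡ downFrom ∣ n - k ∣
    λ-D     : D λ′
    λ-lower : All (λ p → n - k + 1ℤ ≤ + p) λ′
    λ-upper : All (λ p → + p ≤ n + k) λ′
    μ-E     : E μ
    μ-upper : All (λ p → + p ≤ + 2 * k) μ

P : ℤ → ℤ → Set
P n k = Σ Triple (InP n k)

-- The singleton set {m}.
Only : ℤ → Set
Only m = ∃ ｛ m ｝

infix 5 _·q^_

-- s ·q^ e is the formal signed power ±qᵉ.
record SignedPower : Set where
  constructor _·q^_
  field
    sign     : Sign
    exponent : ℤ

-1^_ : ℕ → Sign
-1^ zero  = Sign.+
-1^ suc l = Sign.opposite (-1^ l)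

q^_·_ : ℤ → SignedPower → SignedPower
q^ m · (s ·q^ e) = s ·q^ (m + e)

tripleWeight : Triple → SignedPower
tripleWeight (triple τ λ′ μ) = (-1^ length λ′) ·q^ (+ (sum τ ℕ.+ sum λ′ ℕ.+ sum μ))

weightP : ∀ {n k} → P n k → SignedPower
weightP (t , _) = tripleWeight t

weightPair : ∀ {m n k} → Only m × P n k → SignedPower
weightPair ((m , _) , α) = q^ m · weightP α

w : ∀ {m n k n′ k′} → P n k ⊎ (Only m × P n′ k′) → SignedPower
w = [ weightP , weightPair ]

{-# OPTIONS --safe #-}
-- For 1 ≤ k put m = n - k and N = n + k.  Then λ in P_{n,k} is a core, with
-- distinct parts in [m+1, N-2] as in P_{n-1,k-1}, together with a subset S of
-- {N-1, N}; λ in P_{n-2,k} is such a core together with a subset T of {m-1, m}.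
-- The even partitions μ for k are those for k-1 with copies of 2k added.  Fixing
-- the core and exchanging N-1 with m-1 and N with m:
--   S = ∅, no part 2k   ↦  P_{n-1,k-1};
--   S = ∅, some part 2k ↦  T = ∅ and one part 2k fewer;
--   |S| = 1             ↦  |T| = 1 and the same μ;
--   S = {N-1, N}        ↦  T = {m-1, m} and one part 2k more;
--   2n-1 and (λ, μ)     ↦  T = {m-1, m} and no part 2k.
-- The differences of weight come out right because N = m + 2k, 2N - 1 = (2n - 1) + 2k
-- and |τ| drops by 2m - 3 = (2n - 3) - 2k.  For k = 0 only two singletons remain.
module Submission where

open import Defs
open import Data.Nat using (ℕ)
open import Data.Integer using (ℤ; +_; 0ℤ; _-_; _*_; _≤_)
open import Data.Product using (Σ-syntax; _×_)
open import Data.Sum using (_⊎_)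
open import Function.Bundles using (_⤖_; module Bijection)
open import Relation.Binary.PropositionalEquality using (_≡_)

open import Axiom.UniquenessOfIdentityProofs using (module Decidable⇒UIP)
open import Data.Empty using (⊥-elim)
open import Data.Integer using (1ℤ; -[1+_]; +≤+; ∣_∣)
import Data.Integer as ℤ
import Data.Integer.Properties as ℤ
open import Data.List using (List; []; _∷_; length; downFrom; foldr; _++_)
open import Data.List.Membership.DecPropositional Data.Nat._≟_ using (_∈?_)
open import Data.List.Membership.Propositional using (_∈_; _∉_)
open import Data.List.Membership.Propositional.Properties using (∈-∃++)
open import Data.List.Properties using (≡-dec)
open import Data.List.Relation.Binary.Permutation.Propositional
  using (_↭_; prep; ↭-sym; ↭-trans; ↭⇒↭ₛ)
open import Data.List.Relation.Binary.Permutation.Propositional.Properties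
  using (All-resp-↭; ∈-resp-↭; ↭-length; shift; drop-∷)
import Data.List.Relation.Binary.Permutation.Setoid.Properties as Setoidₚ
open import Data.List.Relation.Binary.Pointwise using (Pointwise-≡⇒≡)
open import Data.List.Relation.Unary.All as All using (All; []; _∷_)
import Data.List.Relation.Unary.AllPairs as AllPairs
open import Data.List.Relation.Unary.AllPairs using (_∷_)
open import Data.List.Relation.Unary.Any using (here)
open import Data.List.Relation.Unary.Linked as Linked using (Linked; [])
open import Data.List.Relation.Unary.Sorted.TotalOrder.Properties using (↗↭↗⇒≋)
open import Data.List.Relation.Unary.Unique.Propositional using (Unique)
import Data.List.Sort
open import Data.Nat using (zero; suc; z≤n; s≤s; _≥_)
import Data.Nat as ℕ
open import Data.Nat.Divisibility using (_∣_; divides; m∣m*n)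
open import Data.Nat.ListAction using (sum)
open import Data.Nat.ListAction.Properties using (sum-↭)
import Data.Nat.Properties as ℕ
open import Data.Nat.Tactic.RingSolver using (solve-∀)
open import Data.Product using (∃; _,_; proj₁; proj₂)
open import Data.Product.Function.NonDependent.Propositional using (_×-↔_)
open import Data.Sign.Properties using (opposite-involutive)
open import Data.Sum using (inj₁; inj₂; [_,_])
open import Data.Sum.Function.Propositional using (_⊎-↔_)
open import Function.Base using (_∘_)
open import Function.Bundles using (_↔_; mk↔ₛ′; module Inverse)
open import Function.Properties.Inverse using (↔⇒⤖; ↔-refl; ↔-sym; ↔-trans)
open import Relation.Binary.Bundles using (DecTotalOrder)
open import Relation.Binary.Construct.Flip.EqAndOrd using (decTotalOrder)
open import Relation.Binary.Definitions using (_Respects_)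
open import Relation.Binary.PropositionalEquality
  using (_≢_; refl; sym; trans; cong; cong₂; subst; setoid; module ≡-Reasoning)
open import Relation.Nullary using (¬_; yes; no)
open import Relation.Unary using (Pred; Irrelevant)
open import Level using (0ℓ)

-- Multisets as nonincreasing lists

private
  -- In the flipped order, ascending means nonincreasing, so `sort` returns lists ordered like
  -- partitions.
  ≥-order : DecTotalOrder 0ℓ 0ℓ 0ℓ
  ≥-order = decTotalOrder ℕ.≤-decTotalOrder

open Data.List.Sort ≥-order using (sort; sort-↭; sort-↗)

sorted-↭⇒≡ : ∀ {xs ys} → Linked _≥_ xs → Linked _≥_ ys → xs ↭ ys → xs ≡ ys
sorted-↭⇒≡ xs↘ ys↘ xs↭ys =
  Pointwise-≡⇒≡ (↗↭↗⇒≋ (DecTotalOrder.totalOrder ≥-order) xs↘ ys↘ (↭⇒↭ₛ xs↭ys))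

Decreasing : Pred (List ℕ) 0ℓ → Set
Decreasing X = Σ[ xs ∈ List ℕ ] Linked _≥_ xs × X xs

-- Irrelevance lets the underlying list decide equality in `Decreasing`; invariance under `_↭_` lets
-- a list be re-sorted after a part is inserted or deleted.
record IsMultisetProperty (X : Pred (List ℕ) 0ℓ) : Set where
  field
    irrelevant : Irrelevant X
    resp-↭     : X Respects _↭_

open IsMultisetProperty

Decreasing-≡ : ∀ {X} → Irrelevant X → {α β : Decreasing X} → proj₁ α ≡ proj₁ β → α ≡ β
Decreasing-≡ irr {xs , p , x} {.xs , q , y} refl =
  cong (xs ,_) (cong₂ _,_ (Linked.irrelevant ℕ.≤-irrelevant p q) (irr x y))

Decreasing-↭⇒≡ : ∀ {X} → Irrelevant X → {α β : Decreasing X} → proj₁ α ↭ proj₁ β → α ≡ β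
Decreasing-↭⇒≡ irr {_ , p , _} {_ , q , _} σ = Decreasing-≡ irr (sorted-↭⇒≡ p q σ)

∈⇒↭∷ : ∀ {x : ℕ} {xs} → x ∈ xs → ∃ λ ys → xs ↭ x ∷ ys
∈⇒↭∷ {x} x∈xs with ys , zs , refl ← ∈-∃++ x∈xs = ys ++ zs , shift x ys zs

-- X splits into the multisets without c, described by Y, and those obtained
-- from a multiset in Z by adding one copy of c.
record Splits (c : ℕ) (X Y Z : Pred (List ℕ) 0ℓ) : Set where
  field
    avoid   : ∀ {xs} → c ∉ xs → X xs → Y xs
    unavoid : ∀ {xs} → Y xs → X xs
    avoids  : ∀ {xs} → Y xs → c ∉ xs
    remove  : ∀ {xs} → X (c ∷ xs) → Z xs
    add     : ∀ {xs} → Z xs → X (c ∷ xs)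

module _ {c X Y Z} (X! : IsMultisetProperty X) (Y! : IsMultisetProperty Y)
         (Z! : IsMultisetProperty Z) (splits : Splits c X Y Z) where

  open Splits splits

  private
    to : Decreasing X → Decreasing Y ⊎ Decreasing Z
    to (xs , xs↘ , x) with c ∈? xs
    ... | no  c∉xs = inj₁ (xs , xs↘ , avoid c∉xs x)
    ... | yes c∈xs with ys , σ ← ∈⇒↭∷ c∈xs =
      inj₂ (sort ys , sort-↗ ys , resp-↭ Z! (↭-sym (sort-↭ ys)) (remove (resp-↭ X! σ x)))

    from : Decreasing Y ⊎ Decreasing Z → Decreasing X
    from (inj₁ (xs , xs↘ , y)) = xs , xs↘ , unavoid y
    from (inj₂ (xs , xs↘ , z)) =
      sort (c ∷ xs) , sort-↗ (c ∷ xs) , resp-↭ X! (↭-sym (sort-↭ (c ∷ xs))) (add z)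

    to∘from : ∀ α → to (from α) ≡ α
    to∘from (inj₁ (xs , xs↘ , y)) with c ∈? xs
    ... | no  _    = cong inj₁ (Decreasing-≡ (irrelevant Y!) refl)
    ... | yes c∈xs = ⊥-elim (avoids y c∈xs)
    to∘from (inj₂ (xs , xs↘ , z)) with c ∈? sort (c ∷ xs)
    ... | no  c∉   = ⊥-elim (c∉ (∈-resp-↭ (↭-sym (sort-↭ (c ∷ xs))) (here refl)))
    -- The remainder `ys` found by the search need not be `xs`, but `c ∷ ys` and `c ∷ xs` are
    -- permutations of the same list, and `c` cancels.
    ... | yes c∈   with ys , σ ← ∈⇒↭∷ c∈ = cong inj₂ (Decreasing-↭⇒≡ (irrelevant Z!)
      (↭-trans (sort-↭ ys) (drop-∷ (↭-trans (↭-sym σ) (sort-↭ (c ∷ xs))))))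

    from∘to : ∀ α → from (to α) ≡ α
    from∘to (xs , xs↘ , x) with c ∈? xs
    ... | no  _    = Decreasing-≡ (irrelevant X!) refl
    ... | yes c∈xs with ys , σ ← ∈⇒↭∷ c∈xs = Decreasing-↭⇒≡ (irrelevant X!)
      (↭-trans (sort-↭ (c ∷ sort ys)) (↭-trans (prep c (sort-↭ ys)) (↭-sym σ)))

  -- Membership of `c` selects the summand. Both round trips preserve the multiset, and a multiset
  -- has only one nonincreasing arrangement.
  split : Decreasing X ↔ (Decreasing Y ⊎ Decreasing Z)
  split = mk↔ₛ′ to from to∘from from∘to

-- Splitting off one admissible value

Distinct : Pred ℕ 0ℓ → Pred (List ℕ) 0ℓ
Distinct R xs = Unique xs × All R xs

All-isMultisetProperty : ∀ {R : Pred ℕ 0ℓ} → Irrelevant R → IsMultisetProperty (All R)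
All-isMultisetProperty irr = record { irrelevant = All.irrelevant irr ; resp-↭ = All-resp-↭ }

-- Two proofs of a disequality are functions into a proof-irrelevant `⊥`, hence definitionally
-- equal.
Unique-irrelevant : Irrelevant (Unique {A = ℕ})
Unique-irrelevant = AllPairs.irrelevant (λ _ _ → refl)

Distinct-isMultisetProperty : ∀ {R} → Irrelevant R → IsMultisetProperty (Distinct R)
Distinct-isMultisetProperty irr = record
  { irrelevant = λ (u , r) (u′ , r′) →
      cong₂ _,_ (Unique-irrelevant u u′) (All.irrelevant irr r r′)
  ; resp-↭     = λ σ (u , r) →
      Setoidₚ.Unique-resp-↭ (setoid ℕ) (↭⇒↭ₛ σ) u , All-resp-↭ σ r
  }

record _≐_∪｛_｝ (R Q : Pred ℕ 0ℓ) (c : ℕ) : Set where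
  field
    other : ∀ {p} → p ≢ c → R p → Q p
    old   : ∀ {p} → Q p → R p
    new   : R c
    fresh : ¬ Q c

module _ {R Q : Pred ℕ 0ℓ} {c : ℕ} (R≐ : R ≐ Q ∪｛ c ｝) where

  open _≐_∪｛_｝ R≐

  private
    All-avoid : ∀ {xs} → c ∉ xs → All R xs → All Q xs
    All-avoid c∉xs rs =
      All.tabulate λ p∈xs → other (λ { refl → c∉xs p∈xs }) (All.lookup rs p∈xs)

    All-avoids : ∀ {xs} → All Q xs → c ∉ xs
    All-avoids qs c∈xs = fresh (All.lookup qs c∈xs)

  -- Parts may repeat: deleting one `c` can leave further copies, so the remainder is constrained by
  -- `R` again.
  All-splits : Splits c (All R) (All Q) (All R)
  All-splits = record
    { avoid   = All-avoid
    ; unavoid = All.map old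
    ; avoids  = All-avoids
    ; remove  = All.tail
    ; add     = new ∷_
    }

  -- A second `c` is impossible, so the remainder obeys `Q` in both cases: `c` is an optional part.
  Distinct-splits : Splits c (Distinct R) (Distinct Q) (Distinct Q)
  Distinct-splits = record
    { avoid   = λ c∉xs (u , rs) → u , All-avoid c∉xs rs
    ; unavoid = λ (u , qs) → u , All.map old qs
    ; avoids  = λ (_ , qs) → All-avoids qs
    ; remove  = λ { (c≢ ∷ u , _ ∷ rs) →
        u , All-avoid (λ c∈xs → All.lookup c≢ c∈xs refl) rs }
    ; add     = λ (u , qs) →
        All.tabulate (λ { p∈xs refl → All-avoids qs p∈xs }) ∷ u , new ∷ All.map old qs
    }

-- The ranges allowed for the parts of λ and μ

Between : ℕ → ℕ → Pred ℕ 0ℓ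
Between lo hi p = lo ℕ.≤ p × p ℕ.≤ hi

EvenUpTo : ℕ → Pred ℕ 0ℓ
EvenUpTo b p = 0 ℕ.< p × 2 ∣ p × p ℕ.≤ b

Between-irrelevant : ∀ {lo hi} → Irrelevant (Between lo hi)
Between-irrelevant (p , q) (p′ , q′) =
  cong₂ _,_ (ℕ.≤-irrelevant p p′) (ℕ.≤-irrelevant q q′)

2∣-irrelevant : Irrelevant (2 ∣_)
2∣-irrelevant (divides q eq) (divides q′ eq′)
  with refl ← ℕ.*-cancelʳ-≡ q q′ 2 (trans (sym eq) eq′) =
  cong (divides q) (ℕ.≡-irrelevant eq eq′)

EvenUpTo-irrelevant : ∀ {b} → Irrelevant (EvenUpTo b)
EvenUpTo-irrelevant (p , q , r) (p′ , q′ , r′) = cong₂ _,_ (ℕ.≤-irrelevant p p′)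
  (cong₂ _,_ (2∣-irrelevant q q′) (ℕ.≤-irrelevant r r′))

Between-top : ∀ {lo hi} → lo ℕ.≤ suc hi → Between lo (suc hi) ≐ Between lo hi ∪｛ suc hi ｝
Between-top lo≤ = record
  { other = λ p≢ (l , u) → l , ℕ.s≤s⁻¹ (ℕ.≤∧≢⇒< u p≢)
  ; old   = λ (l , u) → l , ℕ.m≤n⇒m≤1+n u
  ; new   = lo≤ , ℕ.≤-refl
  ; fresh = λ (_ , u) → ℕ.1+n≰n u
  }

Between-bottom : ∀ {lo hi} → lo ℕ.≤ hi → Between lo hi ≐ Between (suc lo) hi ∪｛ lo ｝
Between-bottom lo≤ = record
  { other = λ p≢ (l , u) → ℕ.≤∧≢⇒< l (p≢ ∘ sym) , u
  ; old   = λ (l , u) → ℕ.<⇒≤ l , u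
  ; new   = ℕ.≤-refl , lo≤
  ; fresh = λ (l , _) → ℕ.1+n≰n l
  }

-- Comparing halves skips the odd number in between: `q ≤ suc k` and `q ≢ suc k` give `q ≤ k`.
EvenUpTo-top : ∀ k → EvenUpTo (2 ℕ.* suc k) ≐ EvenUpTo (2 ℕ.* k) ∪｛ 2 ℕ.* suc k ｝
EvenUpTo-top k = record
  { other = λ { p≢ (0<p , divides q refl , u) → 0<p , divides q refl , below q p≢ u }
  ; old   = λ (0<p , 2∣p , u) → 0<p , 2∣p , ℕ.≤-trans u (ℕ.*-monoʳ-≤ 2 (ℕ.n≤1+n k))
  ; new   = s≤s z≤n , m∣m*n (suc k) , ℕ.≤-refl
  ; fresh = λ (_ , _ , u) → ℕ.1+n≰n (ℕ.*-cancelˡ-≤ 2 u)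
  }
  where
  below : ∀ q → q ℕ.* 2 ≢ 2 ℕ.* suc k → q ℕ.* 2 ℕ.≤ 2 ℕ.* suc k → q ℕ.* 2 ℕ.≤ 2 ℕ.* k
  below q p≢ u rewrite ℕ.*-comm q 2 =
    ℕ.*-monoʳ-≤ 2 {q} {k} (ℕ.s≤s⁻¹ (ℕ.≤∧≢⇒< (ℕ.*-cancelˡ-≤ 2 u) (p≢ ∘ cong (2 ℕ.*_))))

Λ : ℕ → ℕ → Set
Λ lo hi = Decreasing (Distinct (Between lo hi))

M : ℕ → Set
M b = Decreasing (All (EvenUpTo b))

Between-isMultisetProperty : ∀ {lo hi} → IsMultisetProperty (Distinct (Between lo hi))
Between-isMultisetProperty = Distinct-isMultisetProperty Between-irrelevant

EvenUpTo-isMultisetProperty : ∀ {b} → IsMultisetProperty (All (EvenUpTo b))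
EvenUpTo-isMultisetProperty = All-isMultisetProperty EvenUpTo-irrelevant

Λ-≡ : ∀ {lo hi} {α β : Λ lo hi} → proj₁ α ≡ proj₁ β → α ≡ β
Λ-≡ = Decreasing-≡ (irrelevant Between-isMultisetProperty)

M-≡ : ∀ {b} {α β : M b} → proj₁ α ≡ proj₁ β → α ≡ β
M-≡ = Decreasing-≡ (irrelevant EvenUpTo-isMultisetProperty)

split-Λ : ∀ {lo hi lo′ hi′ c} → Between lo hi ≐ Between lo′ hi′ ∪｛ c ｝ →
  Λ lo hi ↔ (Λ lo′ hi′ ⊎ Λ lo′ hi′)
split-Λ R≐ = split Between-isMultisetProperty Between-isMultisetProperty
  Between-isMultisetProperty (Distinct-splits R≐)

split-M : ∀ k → M (2 ℕ.* suc k) ↔ (M (2 ℕ.* k) ⊎ M (2 ℕ.* suc k))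
split-M k = split EvenUpTo-isMultisetProperty EvenUpTo-isMultisetProperty
  EvenUpTo-isMultisetProperty (All-splits (EvenUpTo-top k))

-- Weight-preserving bijections

infix 4 _≅_
infixr 1 _⟫_

-- The weight condition sits on `from` because the inverse of `split` merely re-inserts parts and so
-- computes, whereas its forward map branches on membership.
record _≅_ {A B : Set} (u : A → SignedPower) (v : B → SignedPower) : Set where
  field
    iso       : A ↔ B
    preserves : ∀ b → u (Inverse.from iso b) ≡ v b

open _≅_

≅-sym : ∀ {A B} {u : A → SignedPower} {v : B → SignedPower} → u ≅ v → v ≅ u
≅-sym {u = u} {v} f = record
  { iso       = ↔-sym (iso f)
  ; preserves = λ a →
      trans (sym (preserves f (to a))) (cong u (strictlyInverseʳ a))
  }
  where open Inverse (iso f)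

_⟫_ : ∀ {A B C} {u : A → SignedPower} {v : B → SignedPower} {x : C → SignedPower} →
  u ≅ v → v ≅ x → u ≅ x
f ⟫ g = record
  { iso       = ↔-trans (iso f) (iso g)
  ; preserves = λ c → trans (preserves f _) (preserves g c)
  }

⊎-≅ : ∀ {A B C D} {u : A → SignedPower} {v : B → SignedPower}
  {x : C → SignedPower} {y : D → SignedPower} →
  u ≅ v → x ≅ y → [ u , x ] ≅ [ v , y ]
⊎-≅ f g = record
  { iso       = iso f ⊎-↔ iso g
  ; preserves = λ { (inj₁ b) → preserves f b ; (inj₂ d) → preserves g d }
  }

pull-≅ : ∀ {A B} {u : A → SignedPower} (f : A ↔ B) → u ≅ u ∘ Inverse.from f
pull-≅ f = record { iso = f ; preserves = λ _ → refl }

-- `Only m` is a one-point set, so it drops out of the bijection and survives only as a factor of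
-- the weight.
weightPair-≅ : ∀ {m n k B} {v : B → SignedPower} {d} → m ≡ + d → weightP {n} {k} ≅ v →
  weightPair {m} {n} {k} ≅ (λ b → q^ + d · v b)
weightPair-≅ {d = d} refl f = record
  { iso       = ↔-trans
      (mk↔ₛ′ proj₂ ((_ , refl) ,_) (λ _ → refl) (λ { ((_ , refl) , _) → refl })) (iso f)
  ; preserves = λ b → cong (q^ + d ·_) (preserves f b)
  }

-- Serves k = 0: the summands built on index k - 1 are empty, which leaves the first summand on the
-- left facing the second on the right.
⊎-transfer-≅ : ∀ {A B C D} {u : A → SignedPower} {v : B → SignedPower}
  {x : C → SignedPower} {y : D → SignedPower} →
  u ≅ v → ¬ C → ¬ D → [ u , x ] ≅ [ y , v ]
⊎-transfer-≅ f ¬C ¬D = record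
  { iso       = mk↔ₛ′
      [ inj₂ ∘ to , ⊥-elim ∘ ¬C ] [ ⊥-elim ∘ ¬D , inj₁ ∘ from ]
      [ ⊥-elim ∘ ¬D , cong inj₂ ∘ strictlyInverseˡ ]
      [ cong inj₁ ∘ strictlyInverseʳ , ⊥-elim ∘ ¬C ]
  ; preserves = [ ⊥-elim ∘ ¬D , preserves f ]
  }
  where open Inverse (iso f)

-- The sets P as products of choices of λ and μ

open Decidable⇒UIP (≡-dec ℕ._≟_) renaming (≡-irrelevant to List-≡-irrelevant)

m+n-n≡m : ∀ {i m n} → i ≡ m ℕ.+ n → + i - + n ≡ + m
m+n-n≡m {m = m} {n} refl = trans (ℤ.[+m]-[+n]≡m⊖n (m ℕ.+ n) n)
  (trans (ℤ.⊖-≥ (ℕ.m≤n+m n m)) (cong +_ (ℕ.m+n∸n≡m m n)))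

InP-irrelevant : ∀ {n k} → Irrelevant (InP n k)
InP-irrelevant
  (mkInP p₁ p₂ p₃ (mkD (mkIsPartition p₄ p₅) p₆) p₇ p₈ (mkE (mkIsPartition p₉ p₁₀) p₁₁) p₁₂)
  (mkInP q₁ q₂ q₃ (mkD (mkIsPartition q₄ q₅) q₆) q₇ q₈ (mkE (mkIsPartition q₉ q₁₀) q₁₁) q₁₂)
  with refl ← ℤ.≤-irrelevant p₁ q₁ | refl ← ℤ.≤-irrelevant p₂ q₂
     | refl ← List-≡-irrelevant p₃ q₃
     | refl ← Linked.irrelevant ℕ.≤-irrelevant p₄ q₄ | refl ← All.irrelevant ℕ.≤-irrelevant p₅ q₅
     | refl ← Unique-irrelevant p₆ q₆
     | refl ← All.irrelevant ℤ.≤-irrelevant p₇ q₇ | refl ← All.irrelevant ℤ.≤-irrelevant p₈ q₈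
     | refl ← Linked.irrelevant ℕ.≤-irrelevant p₉ q₉ | refl ← All.irrelevant ℕ.≤-irrelevant p₁₀ q₁₀
     | refl ← All.irrelevant 2∣-irrelevant p₁₁ q₁₁ | refl ← All.irrelevant ℤ.≤-irrelevant p₁₂ q₁₂
  = refl

P-≡ : ∀ {n k} {α β : P n k} → proj₁ α ≡ proj₁ β → α ≡ β
P-≡ {α = t , p} {.t , q} refl = cong (t ,_) (InP-irrelevant p q)

modelWeight : ∀ t {lo hi b} → Λ lo hi × M b → SignedPower
modelWeight t ((xs , _) , (ys , _)) = tripleWeight (triple (downFrom t) xs ys)

module _ {n k : ℤ} {t h b : ℕ} (0≤k : 0ℤ ≤ k) (k≤n : k ≤ n)
         (n-k≡t : n - k ≡ + t) (n+k≡h : n ℤ.+ k ≡ + h) (2k≡b : + 2 * k ≡ + b) where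

  private
    n-k+1≡1+t : n - k ℤ.+ 1ℤ ≡ + suc t
    n-k+1≡1+t = trans (cong (ℤ._+ 1ℤ) n-k≡t) (cong +_ (ℕ.+-comm t 1))

    ∣n-k∣≡t : ∣ n - k ∣ ≡ t
    ∣n-k∣≡t = cong ∣_∣ n-k≡t

    to : P n k → Λ (suc t) h × M b
    to (triple _ xs ys , p) =
      (xs , IsPartition.nonincreasing (D.isPartition λ-D) , D.distinct λ-D ,
        All.zipWith (λ (l , u) →
          ℤ.drop‿+≤+ (subst (_≤ _) n-k+1≡1+t l) , ℤ.drop‿+≤+ (subst (_ ≤_) n+k≡h u))
          (λ-lower , λ-upper)) ,
      (ys , IsPartition.nonincreasing (E.isPartition μ-E) ,
        All.zip (IsPartition.positive (E.isPartition μ-E) ,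
          All.zip (E.even μ-E ,
            All.map (λ u → ℤ.drop‿+≤+ (subst (_ ≤_) 2k≡b u)) μ-upper)))
      where open InP p

    from : Λ (suc t) h × M b → P n k
    from ((xs , xs↘ , u , rs) , (ys , ys↘ , es)) = triple (downFrom t) xs ys , record
      { 0≤k     = 0≤k
      ; k≤n     = k≤n
      ; τ-fixed = cong downFrom (sym ∣n-k∣≡t)
      -- Positivity of the parts comes from the lower bound `suc t`.
      ; λ-D     = mkD (mkIsPartition xs↘ (All.map (λ (l , _) → ℕ.≤-trans (s≤s z≤n) l) rs)) u
      ; λ-lower = All.map (λ (l , _) → subst (_≤ _) (sym n-k+1≡1+t) (+≤+ l)) rs
      ; λ-upper = All.map (λ (_ , u) → subst (_ ≤_) (sym n+k≡h) (+≤+ u)) rs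
      ; μ-E     = mkE (mkIsPartition ys↘ (All.map proj₁ es)) (All.map (proj₁ ∘ proj₂) es)
      ; μ-upper = All.map (λ (_ , _ , u) → subst (_ ≤_) (sym 2k≡b) (+≤+ u)) es
      }

  -- `τ` is forced, so only `λ′` and `μ` are free, independently of each other. From here on the
  -- integers n - k, n + k and 2k are the naturals `t`, `h` and `b`.
  P-model : weightP {n} {k} ≅ modelWeight t
  P-model = record
    { iso       = mk↔ₛ′ to from
        (λ _ → cong₂ _,_ (Λ-≡ refl) (M-≡ refl))
        (λ (_ , p) → P-≡ (cong (λ τ → triple τ _ _)
          (sym (trans (InP.τ-fixed p) (cong downFrom ∣n-k∣≡t)))))
    ; preserves = λ _ → refl
    }

-- Weights after adjoining parts

-- Uses the same `sort (c ∷ _)` as the inverse of `split`, so the lists produced by iterated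
-- splittings have this form definitionally.
adjoin : List ℕ → List ℕ → List ℕ
adjoin cs xs = foldr (λ c ys → sort (c ∷ ys)) xs cs

length-adjoin : ∀ cs xs → length (adjoin cs xs) ≡ length cs ℕ.+ length xs
length-adjoin []       xs = refl
length-adjoin (c ∷ cs) xs =
  trans (↭-length (sort-↭ (c ∷ adjoin cs xs))) (cong suc (length-adjoin cs xs))

sum-adjoin : ∀ cs xs → sum (adjoin cs xs) ≡ sum cs ℕ.+ sum xs
sum-adjoin []       xs = refl
sum-adjoin (c ∷ cs) xs = trans (sum-↭ (sort-↭ (c ∷ adjoin cs xs)))
  (trans (cong (c ℕ.+_) (sum-adjoin cs xs)) (sym (ℕ.+-assoc c (sum cs) (sum xs))))

-- For `d` equal to 0 the prefactor vanishes by computation, so elements with and without a factor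
-- q^m are treated alike.
adjoinWeight : ℕ → List ℕ → List ℕ → List ℕ → List ℕ → List ℕ → SignedPower
adjoinWeight d τ cs es xs ys = q^ + d · tripleWeight (triple τ (adjoin cs xs) (adjoin es ys))

adjoinWeight-normal : ∀ d τ cs es xs ys → adjoinWeight d τ cs es xs ys ≡
  -1^ (length cs ℕ.+ length xs) ·q^
    + ((d ℕ.+ (sum τ ℕ.+ sum cs ℕ.+ sum es)) ℕ.+ (sum xs ℕ.+ sum ys))
adjoinWeight-normal d τ cs es xs ys = cong₂ _·q^_ (cong -1^_ (length-adjoin cs xs)) (cong +_ (begin
  d ℕ.+ (sum τ ℕ.+ sum (adjoin cs xs) ℕ.+ sum (adjoin es ys))
    ≡⟨ cong₂ (λ u v → d ℕ.+ (sum τ ℕ.+ u ℕ.+ v)) (sum-adjoin cs xs) (sum-adjoin es ys) ⟩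
  d ℕ.+ (sum τ ℕ.+ (sum cs ℕ.+ sum xs) ℕ.+ (sum es ℕ.+ sum ys))
    ≡⟨ regroup d (sum τ) (sum cs) (sum es) (sum xs) (sum ys) ⟩
  (d ℕ.+ (sum τ ℕ.+ sum cs ℕ.+ sum es)) ℕ.+ (sum xs ℕ.+ sum ys) ∎))
  where
  open ≡-Reasoning
  regroup : ∀ d t c e x y →
    d ℕ.+ (t ℕ.+ (c ℕ.+ x) ℕ.+ (e ℕ.+ y)) ≡ (d ℕ.+ (t ℕ.+ c ℕ.+ e)) ℕ.+ (x ℕ.+ y)
  regroup = solve-∀

-- The common `xs` and `ys` contribute equally to both sides. What remains is a sign comparison and
-- one identity of naturals in the adjoined data.
adjoinWeight-≡ : ∀ d τ cs es d′ τ′ cs′ es′ →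
  (∀ l → -1^ (length cs ℕ.+ l) ≡ -1^ (length cs′ ℕ.+ l)) →
  d ℕ.+ (sum τ ℕ.+ sum cs ℕ.+ sum es) ≡ d′ ℕ.+ (sum τ′ ℕ.+ sum cs′ ℕ.+ sum es′) →
  ∀ xs ys → adjoinWeight d τ cs es xs ys ≡ adjoinWeight d′ τ′ cs′ es′ xs ys
adjoinWeight-≡ d τ cs es d′ τ′ cs′ es′ signs exponents xs ys =
  trans (adjoinWeight-normal d τ cs es xs ys)
    (trans (cong₂ _·q^_ (signs (length xs)) (cong (λ e → + (e ℕ.+ (sum xs ℕ.+ sum ys))) exponents))
      (sym (adjoinWeight-normal d′ τ′ cs′ es′ xs ys)))

-- The case k = 0

Λ-empty : ∀ {h} (α : Λ (suc h) h) → proj₁ α ≡ []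
Λ-empty ([] , _) = refl
Λ-empty (_ ∷ _ , _ , _ , (l , u) ∷ _) = ⊥-elim (ℕ.1+n≰n (ℕ.≤-trans l u))

M-empty : (α : M 0) → proj₁ α ≡ []
M-empty ([] , _) = refl
M-empty (_ ∷ _ , _ , (0<p , _ , p≤0) ∷ _) = ⊥-elim (ℕ.1+n≰n (ℕ.≤-trans 0<p p≤0))

module KZero (a : ℕ) where

  point : ∀ {h} → Λ (suc h) h × M 0
  point = ([] , [] , AllPairs.[] , []) , ([] , [] , [])

  point-unique : ∀ {h} (α : Λ (suc h) h × M 0) → point ≡ α
  point-unique (α , β) = cong₂ _,_ (Λ-≡ (sym (Λ-empty α))) (M-≡ (sym (M-empty β)))

  d : ℕ
  d = suc (a ℕ.+ a)

  -- With n = a + 2, passing to n - 2 drops the entries a + 1 and a of τ; their sum 2a + 1 = 2n - 3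
  -- is `d`.
  points-≅ : modelWeight (suc (suc a)) {suc (suc (suc a))} {suc (suc a)} {0}
    ≅ (λ α → q^ + d · modelWeight a {suc a} {a} {0} α)
  points-≅ = record
    { iso       = mk↔ₛ′ (λ _ → point) (λ _ → point) point-unique point-unique
    -- At `point` both weights compute; uniqueness carries the equation to `α`.
    ; preserves = λ α → subst
        (λ α → modelWeight (suc (suc a)) {suc (suc (suc a))} {suc (suc a)} {0} point
               ≡ q^ + d · modelWeight a α)
        (point-unique α)
        (cong (λ e → -1^ 0 ·q^ + e) (exponents a (sum (downFrom a))))
    }
    where
    exponents : ∀ a s → suc a ℕ.+ (a ℕ.+ s) ℕ.+ 0 ℕ.+ 0 ≡ suc (a ℕ.+ a) ℕ.+ (s ℕ.+ 0 ℕ.+ 0)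
    exponents = solve-∀

  φ-≅ : w {+ 2 * + suc (suc a) - + 1} {+ suc (suc a)} {0ℤ} {+ suc a} { -[1+ 0 ]}
      ≅ w {+ 2 * + suc (suc a) - + 3} {+ suc a} { -[1+ 0 ]} {+ a} {0ℤ}
  φ-≅ = ⊎-transfer-≅
    (P-model ℤ.≤-refl (+≤+ z≤n) (ℤ.+-identityʳ _) (ℤ.+-identityʳ _) refl
      ⟫ points-≅
      ⟫ ≅-sym (weightPair-≅ (twice-3 a)
          (P-model ℤ.≤-refl (+≤+ z≤n) (ℤ.+-identityʳ _) (ℤ.+-identityʳ _) refl)))
    (λ { (_ , _ , p) → empty p }) (λ { (_ , p) → empty p })
    where
    empty : ∀ {n t} → ¬ InP n -[1+ 0 ] t
    empty p with () ← InP.0≤k p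

    twice-3 : ∀ a → + 2 * + suc (suc a) - + 3 ≡ + suc (a ℕ.+ a)
    twice-3 a = cong (λ x → + suc (suc x) - + 3) (eq a)
      where
      eq : ∀ a → a ℕ.+ suc (suc (a ℕ.+ 0)) ≡ suc (suc (a ℕ.+ a))
      eq = solve-∀

-- The case k ≥ 1

-- In (L ⊎ L) ⊎ (L ⊎ L), inj₂ means that an optional part is present.  The outer sum is
-- about N on the left and m-1 on the right, the inner one about N-1 and m.
module _ {L M₀ M₁ : Set} (σ : M₁ ↔ (M₀ ⊎ M₁)) where

  private
    module σ = Inverse σ

    Core : Set
    Core = ((L ⊎ L) ⊎ (L ⊎ L)) × (M₀ ⊎ M₁)

    to : Core ⊎ (L × M₀) → (L × M₀) ⊎ Core
    to (inj₁ (inj₁ (inj₁ x) , inj₁ y)) = inj₁ (x , y)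
    -- Here `y` is μ with one part 2k already deleted; `σ.to` asks whether another one is left.
    to (inj₁ (inj₁ (inj₁ x) , inj₂ y)) = inj₂ (inj₁ (inj₁ x) , σ.to y)
    -- N-1 is read at the inner level but its partner m-1 at the outer one, so the two tags trade
    -- places.
    to (inj₁ (inj₁ (inj₂ x) , y))      = inj₂ (inj₂ (inj₁ x) , y)
    to (inj₁ (inj₂ (inj₁ x) , y))      = inj₂ (inj₁ (inj₂ x) , y)
    -- `σ.from` reassembles μ, and the outer `inj₂` adds one more part 2k.
    to (inj₁ (inj₂ (inj₂ x) , y))      = inj₂ (inj₂ (inj₂ x) , inj₂ (σ.from y))
    to (inj₂ (x , y))                  = inj₂ (inj₂ (inj₂ x) , inj₁ y)

    from : (L × M₀) ⊎ Core → Core ⊎ (L × M₀)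
    from (inj₁ (x , y))                      = inj₁ (inj₁ (inj₁ x) , inj₁ y)
    from (inj₂ (inj₁ (inj₁ x) , y))          = inj₁ (inj₁ (inj₁ x) , inj₂ (σ.from y))
    from (inj₂ (inj₂ (inj₁ x) , y))          = inj₁ (inj₁ (inj₂ x) , y)
    from (inj₂ (inj₁ (inj₂ x) , y))          = inj₁ (inj₂ (inj₁ x) , y)
    from (inj₂ (inj₂ (inj₂ x) , inj₂ y))     = inj₁ (inj₂ (inj₂ x) , σ.to y)
    from (inj₂ (inj₂ (inj₂ x) , inj₁ y))     = inj₂ (x , y)

    to∘from : ∀ β → to (from β) ≡ β
    to∘from (inj₁ _)                          = refl
    to∘from (inj₂ (inj₁ (inj₁ x) , y))        = cong (λ z → inj₂ (_ , z)) (σ.strictlyInverseˡ y)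
    to∘from (inj₂ (inj₂ (inj₁ _) , _))        = refl
    to∘from (inj₂ (inj₁ (inj₂ _) , _))        = refl
    to∘from (inj₂ (inj₂ (inj₂ _) , inj₂ y))   =
      cong (λ z → inj₂ (_ , inj₂ z)) (σ.strictlyInverseʳ y)
    to∘from (inj₂ (inj₂ (inj₂ _) , inj₁ _))   = refl

    from∘to : ∀ α → from (to α) ≡ α
    from∘to (inj₁ (inj₁ (inj₁ _) , inj₁ _)) = refl
    from∘to (inj₁ (inj₁ (inj₁ _) , inj₂ y)) =
      cong (λ z → inj₁ (_ , inj₂ z)) (σ.strictlyInverseʳ y)
    from∘to (inj₁ (inj₁ (inj₂ _) , _))      = refl
    from∘to (inj₁ (inj₂ (inj₁ _) , _))      = refl
    from∘to (inj₁ (inj₂ (inj₂ _) , y))      =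
      cong (λ z → inj₁ (_ , z)) (σ.strictlyInverseˡ y)
    from∘to (inj₂ _)                        = refl

  exchange : (Core ⊎ (L × M₀)) ↔ ((L × M₀) ⊎ Core)
  exchange = mk↔ₛ′ to from to∘from from∘to

-- The k of the theorem is k + 1 here, m = a + 2 and N = h + 2.
module KPositive (a k : ℕ) where

  n h b b₀ : ℕ
  n  = suc (suc (suc (a ℕ.+ k)))
  h  = a ℕ.+ 2 ℕ.* suc k
  b  = 2 ℕ.* suc k
  b₀ = 2 ℕ.* k

  -- This is m ≤ N - 2, true because N = m + 2k with k ≥ 1 in the theorem's notation. It places N,
  -- N-1, m-1 and m inside the intervals they are split from.
  2+a≤h : suc (suc a) ℕ.≤ h
  2+a≤h = subst (ℕ._≤ h) (ℕ.+-comm a 2) (ℕ.+-monoʳ-≤ a (ℕ.m≤m*n 2 (suc k)))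

  L : Set
  L = Λ (suc (suc (suc a))) h

  split-top : Λ (suc (suc (suc a))) (suc (suc h)) ↔ ((L ⊎ L) ⊎ (L ⊎ L))
  split-top = ↔-trans (split-Λ (Between-top (s≤s (ℕ.m≤n⇒m≤1+n 2+a≤h)))) (next ⊎-↔ next)
    where next = split-Λ (Between-top (s≤s 2+a≤h))

  split-bottom : Λ (suc a) h ↔ ((L ⊎ L) ⊎ (L ⊎ L))
  split-bottom = ↔-trans (split-Λ (Between-bottom (ℕ.<⇒≤ 2+a≤h))) (next ⊎-↔ next)
    where next = split-Λ (Between-bottom 2+a≤h)

  -- The exponents 2n - 1 and 2n - 3.
  d₁ d₃ : ℕ
  d₁ = 5 ℕ.+ (a ℕ.+ k ℕ.+ (a ℕ.+ k))
  d₃ = 3 ℕ.+ (a ℕ.+ k ℕ.+ (a ℕ.+ k))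

  lhs : (Λ (suc (suc (suc a))) (suc (suc h)) × M b) ⊎ (L × M b₀) → SignedPower
  lhs = [ modelWeight (suc (suc a)) , (λ α → q^ + d₁ · modelWeight (suc (suc a)) α) ]

  rhs : (L × M b₀) ⊎ (Λ (suc a) h × M b) → SignedPower
  rhs = [ modelWeight (suc (suc a)) , (λ α → q^ + d₃ · modelWeight a α) ]

  -- Lowering n and k together keeps n - k, hence τ and the lower bound, and lowers n + k by 2. So
  -- the λ occurring here are exactly the cores.
  core-≅ : weightP {+ n - + 1} {+ suc k - + 1} ≅ modelWeight (suc (suc a)) {suc (suc (suc a))} {h} {b₀}
  core-≅ = P-model {t = suc (suc a)} (+≤+ z≤n) (+≤+ (ℕ.m≤n+m k (suc (suc a)))) (m+n-n≡m {n = k} refl)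
    (cong +_ (exponent a k)) (sym (ℤ.pos-* 2 k))
    where
    exponent : ∀ a k → suc (suc (a ℕ.+ k ℕ.+ k)) ≡ a ℕ.+ 2 ℕ.* suc k
    exponent = solve-∀

  lhs-≅ : w {+ 2 * + n - + 1} {+ n} {+ suc k} {+ n - + 1} {+ suc k - + 1} ≅ lhs
  lhs-≅ = ⊎-≅
    (P-model (+≤+ z≤n) (+≤+ (s≤s (ℕ.m≤n+m k (suc (suc a)))))
      (m+n-n≡m (cong (suc ∘ suc) (sym (ℕ.+-suc a k)))) (cong +_ (top a k)) refl)
    (weightPair-≅ (cong +_ (twice (a ℕ.+ k))) core-≅)
    where
    top : ∀ a k → suc (suc (suc (a ℕ.+ k ℕ.+ suc k))) ≡ suc (suc (a ℕ.+ 2 ℕ.* suc k))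
    top = solve-∀

    twice : ∀ x → suc (suc (x ℕ.+ suc (suc (suc (x ℕ.+ 0))))) ≡ 5 ℕ.+ (x ℕ.+ x)
    twice = solve-∀

  rhs-≅ : w {+ 2 * + n - + 3} {+ n - + 1} {+ suc k - + 1} {+ n - + 2} {+ suc k} ≅ rhs
  rhs-≅ = ⊎-≅ core-≅
    (weightPair-≅ (cong +_ (twice (a ℕ.+ k)))
      (P-model (+≤+ z≤n) (+≤+ (s≤s (ℕ.m≤n+m k a)))
        (m+n-n≡m (sym (ℕ.+-suc a k))) (cong +_ (top a k)) refl))
    where
    top : ∀ a k → suc (a ℕ.+ k ℕ.+ suc k) ≡ a ℕ.+ 2 ℕ.* suc k
    top = solve-∀

    twice : ∀ x → x ℕ.+ suc (suc (suc (x ℕ.+ 0))) ≡ 3 ℕ.+ (x ℕ.+ x)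
    twice = solve-∀

  split-lhs = (split-top ×-↔ split-M k) ⊎-↔ ↔-refl {A = L × M b₀}
  split-rhs = ↔-refl {A = L × M b₀} ⊎-↔ (split-bottom ×-↔ split-M k)

  exchange-≅ : lhs ∘ Inverse.from split-lhs ≅ rhs ∘ Inverse.from split-rhs
  exchange-≅ = record { iso = exchange (split-M k) ; preserves = preserved }
    where
    σ = split-M k
    s = sum (downFrom a)
    τ = downFrom (suc (suc a))
    τ′ = downFrom a

    preserved : ∀ β → lhs (Inverse.from split-lhs (Inverse.from (exchange σ) β))
                    ≡ rhs (Inverse.from split-rhs β)
    preserved (inj₁ _) = refl
    -- The dropped entries of τ, of sum 2a + 1, and the lost part `b` together make `d₃`.
    preserved (inj₂ (inj₁ (inj₁ (xs , _)) , y)) =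
      adjoinWeight-≡ 0 τ [] (b ∷ []) d₃ τ′ [] [] (λ _ → refl) (exponents a k s)
        xs (proj₁ (Inverse.from σ y))
      where
      exponents : ∀ a k s →
        suc a ℕ.+ (a ℕ.+ s) ℕ.+ 0 ℕ.+ (2 ℕ.* suc k ℕ.+ 0)
        ≡ 3 ℕ.+ (a ℕ.+ k ℕ.+ (a ℕ.+ k)) ℕ.+ (s ℕ.+ 0 ℕ.+ 0)
      exponents = solve-∀
    -- Replacing N-1 by m-1 loses exactly `b`, so the balance is as before; likewise for N and m
    -- below.
    preserved (inj₂ (inj₂ (inj₁ (xs , _)) , y)) =
      adjoinWeight-≡ 0 τ (suc h ∷ []) [] d₃ τ′ (suc a ∷ []) [] (λ _ → refl) (exponents a k s)
        xs (proj₁ (Inverse.from σ y))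
      where
      exponents : ∀ a k s →
        suc a ℕ.+ (a ℕ.+ s) ℕ.+ (suc (a ℕ.+ 2 ℕ.* suc k) ℕ.+ 0) ℕ.+ 0
        ≡ 3 ℕ.+ (a ℕ.+ k ℕ.+ (a ℕ.+ k)) ℕ.+ (s ℕ.+ (suc a ℕ.+ 0) ℕ.+ 0)
      exponents = solve-∀
    preserved (inj₂ (inj₁ (inj₂ (xs , _)) , y)) =
      adjoinWeight-≡ 0 τ (suc (suc h) ∷ []) [] d₃ τ′ (suc (suc a) ∷ []) []
        (λ _ → refl) (exponents a k s) xs (proj₁ (Inverse.from σ y))
      where
      exponents : ∀ a k s →
        suc a ℕ.+ (a ℕ.+ s) ℕ.+ (suc (suc (a ℕ.+ 2 ℕ.* suc k)) ℕ.+ 0) ℕ.+ 0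
        ≡ 3 ℕ.+ (a ℕ.+ k ℕ.+ (a ℕ.+ k)) ℕ.+ (s ℕ.+ (suc (suc a) ℕ.+ 0) ℕ.+ 0)
      exponents = solve-∀
    -- Two parts appear in λ where there were none, so the sign flips twice.
    preserved (inj₂ (inj₂ (inj₂ (xs , _)) , inj₁ (ys , _))) =
      adjoinWeight-≡ d₁ τ [] [] d₃ τ′ (suc a ∷ suc (suc a) ∷ []) []
        (λ l → sym (opposite-involutive (-1^ l))) (exponents a k s) xs ys
      where
      exponents : ∀ a k s →
        5 ℕ.+ (a ℕ.+ k ℕ.+ (a ℕ.+ k)) ℕ.+ (suc a ℕ.+ (a ℕ.+ s) ℕ.+ 0 ℕ.+ 0)
        ≡ 3 ℕ.+ (a ℕ.+ k ℕ.+ (a ℕ.+ k)) ℕ.+ (s ℕ.+ (suc a ℕ.+ (suc (suc a) ℕ.+ 0)) ℕ.+ 0)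
      exponents = solve-∀
    -- On the left μ is `σ.from (σ.to y)`, which the rewrite turns into `y`; on the right it is `y`
    -- with one more `b`.
    preserved (inj₂ (inj₂ (inj₂ (xs , _)) , inj₂ y))
      rewrite Inverse.strictlyInverseʳ σ y =
      adjoinWeight-≡ 0 τ (suc (suc h) ∷ suc h ∷ []) [] d₃ τ′ (suc a ∷ suc (suc a) ∷ []) (b ∷ [])
        (λ _ → refl) (exponents a k s) xs (proj₁ y)
      where
      exponents : ∀ a k s →
        suc a ℕ.+ (a ℕ.+ s)
          ℕ.+ (suc (suc (a ℕ.+ 2 ℕ.* suc k)) ℕ.+ (suc (a ℕ.+ 2 ℕ.* suc k) ℕ.+ 0)) ℕ.+ 0
        ≡ 3 ℕ.+ (a ℕ.+ k ℕ.+ (a ℕ.+ k))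
          ℕ.+ (s ℕ.+ (suc a ℕ.+ (suc (suc a) ℕ.+ 0)) ℕ.+ (2 ℕ.* suc k ℕ.+ 0))
      exponents = solve-∀

  φ-≅ : w {+ 2 * + n - + 1} {+ n} {+ suc k} {+ n - + 1} {+ suc k - + 1}
      ≅ w {+ 2 * + n - + 3} {+ n - + 1} {+ suc k - + 1} {+ n - + 2} {+ suc k}
  φ-≅ = lhs-≅ ⟫ pull-≅ split-lhs ⟫ exchange-≅ ⟫ ≅-sym (rhs-≅ ⟫ pull-≅ split-rhs)

-- Conclusion

-- The theorem asks for the weight equation along the forward map, hence the use of `≅-sym`.
≅⇒⤖ : ∀ {A B} {u : A → SignedPower} {v : B → SignedPower} → u ≅ v →
  Σ[ φ ∈ (A ⤖ B) ] (∀ α → v (Bijection.to φ α) ≡ u α)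
≅⇒⤖ f = ↔⇒⤖ (iso f) , preserves (≅-sym f)

theorem3p1 : (n : ℕ) (k : ℤ) → 0ℤ ≤ k → k ≤ + n - + 2 →
    Σ[ φ ∈ (P (+ n) k ⊎ (Only (+ 2 * + n - + 1) × P (+ n - + 1) (k - + 1)))
    ⤖ (P (+ n - + 1) (k - + 1) ⊎ (Only (+ 2 * + n - + 3) × P (+ n - + 2) k)) ]
    (∀ α → w (Bijection.to φ α) ≡ w α)
-- For n < 2 or negative k one of the two bounds is uninhabited.
theorem3p1 (suc (suc a)) (+ zero) _ _ = ≅⇒⤖ (KZero.φ-≅ a)
theorem3p1 (suc (suc n)) (+ suc k) _ (+≤+ 1+k≤n)
  -- `a` is the slack in k ≤ n - 2, so that n - k = a + 2.
  with a , refl ← ℕ.m≤n⇒∃[o]m+o≡n 1+k≤n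
  rewrite ℕ.+-comm k a = ≅⇒⤖ (KPositive.φ-≅ a k)
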